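{- Let $k$ be a positive integer, and write $Q=4^k$ and $q=Q^3$. If $a\in\mathbb{F}_q^*$ is a $(Q-1)$-th power in $\mathbb{F}_q^*$ but not a $3(Q-1)$-th power in $\mathbb{F}_q^*$, then the function $c\mapsto a c^{Q^2+Q}$ is planar on $\mathbb{F}_q$.
   Context: For $q$ a power of $2$, a function $F\colon\mathbb{F}_q\to\mathbb{F}_q$ is called planar if, for every $d\in\mathbb{F}_q^*$, the function $c\mapsto F(c+d)+F(c)+dc$ is a bijection on $\mathbb{F}_q$. -}

module Defs where

open import Data.Nat using (ℕ; zero; suc)
open import Data.Fin using (Fin)
open import Data.Product using (Σ; _×_; ∃)
open import Relation.Binary.PropositionalEquality using (_≡_; _≢_)
open import Algebra.Structures using (IsCommutativeRing)
open import Function.Bundles using (_↔_)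
open import Function.Definitions using (Bijective)

record FiniteField (q : ℕ) : Set₁ where
  infixl 6 _+_
  infixl 7 _*_
  field
    Carrier  : Set
    _+_ _*_  : Carrier → Carrier → Carrier
    -_       : Carrier → Carrier
    0# 1#    : Carrier
    isCommutativeRing : IsCommutativeRing _≡_ _+_ _*_ -_ 0# 1#
    0≢1      : 0# ≢ 1#
    inverse  : ∀ x → x ≢ 0# → Σ Carrier (λ y → x * y ≡ 1#)
    enum     : Fin q ↔ Carrier

  _^_ : Carrier → ℕ → Carrier
  x ^ zero  = 1#
  x ^ suc n = x * (x ^ n)

  IsPowerIn* : ℕ → Carrier → Set
  IsPowerIn* n a = Σ Carrier (λ b → (b ≢ 0#) × (b ^ n ≡ a))

  -- planarity (characteristic 2 definition from the paper)
  Planar : (Carrier → Carrier) → Set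
  Planar F = ∀ d → d ≢ 0# →
    Bijective _≡_ _≡_ (λ c → F (c + d) + F c + d * c)

{-# OPTIONS --safe #-}

-- Write x′ = x ^ Q, so that x‴ = x, and a = b′ / b.  The function to be shown
-- bijective is affine over 𝔽₂, so let e be a nonzero element of the kernel of
-- its linear part, i.e. d e = a (e′ d″ + e″ d′).  With e = d u and
-- h = b d ^ (Q + 2) this reads h u = h′ (u′ + u″).  Conjugating twice and
-- eliminating u, v = u′, w = u″ leaves two cases.  If u + u′ + u″ = 0 then
-- h′ = h; otherwise x = h, y = h′, z = h″ lie on the nodal cubic
--   x² z + y² x + z² y = x y z,
-- on which x N = (x + y) (x + z)² for N = x² + y² + z² + x y + y z + z x.
-- Since N′ = N, in both cases h times an element of 𝔽_Q* is n ^ (Q + 2) for some n.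
-- As 3 divides Q + 2, it follows that a = b ^ (Q − 1) is a 3(Q − 1)-th power.
module Submission where

open import Defs
open import Algebra.Bundles using (CommutativeRing)
import Algebra.Properties.CommutativeMonoid.Sum as Sum
import Algebra.Properties.CommutativeSemigroup as CommutativeSemigroupProperties
import Algebra.Properties.Ring as RingProperties
import Algebra.Solver.Ring as Solver
open import Algebra.Solver.Ring.AlmostCommutativeRing using (_-Raw-AlmostCommutative⟶_; fromCommutativeRing)
open import Data.Bool.Base using (Bool; true; false; if_then_else_)
import Data.Bool.Properties as Bool
open import Data.Fin.Base using (Fin; punchIn; punchOut)
import Data.Fin.Properties as Fin
import Data.Maybe.Base as Maybe
open import Data.Nat using (ℕ; zero; suc; _*_; _^_; _∸_; _+_; NonZero)
import Data.Nat.Properties as ℕ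
import Data.Nat.Solver as ℕSolver
open import Data.Product using (Σ; ∃; _×_; _,_; proj₁; proj₂)
open import Function.Base using (_∘_)
open import Function.Bundles using (_↔_; Inverse; Injection; mk↔ₛ′)
open import Function.Definitions using (Injective; Surjective; Bijective)
open import Function.Properties.Inverse using (↔-sym; ↔-trans; ↔⇒↣)
open import Relation.Binary.Definitions using (DecidableEquality)
open import Relation.Binary.PropositionalEquality using (_≡_; _≢_; refl; sym; trans; cong; cong₂; subst; module ≡-Reasoning)
open import Relation.Nullary using (¬_; yes; no; contradiction)
open import Relation.Nullary.Decidable using (dec⇒maybe)
open FiniteField using (Carrier; 0#; IsPowerIn*; Planar)

-- Finite sets and a divisibility fact

Fin-injective⇒surjective : ∀ {n} (f : Fin n → Fin n) → Injective _≡_ _≡_ f → ∀ j → ∃ λ i → f i ≡ j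
Fin-injective⇒surjective {suc n} f f-inj j with Fin.any? (λ i → f i Fin.≟ j)
... | yes found = found
-- If `j` is missed, punching it out of the codomain yields an injection from `Fin (suc n)` into
-- `Fin n`.
... | no missed = contradiction (Fin.injective⇒≤ avoid-injective) ℕ.1+n≰n
  where
  avoids : ∀ i → j ≢ f i
  avoids i j≡fi = missed (i , sym j≡fi)

  avoid-injective : Injective _≡_ _≡_ (λ i → punchOut (avoids i))
  avoid-injective = f-inj ∘ Fin.punchOut-injective (avoids _) (avoids _)

3∣4^k+2 : ∀ k → ∃ λ j → 4 ^ k + 2 ≡ 3 * j
3∣4^k+2 zero = 1 , refl
3∣4^k+2 (suc k) with 3∣4^k+2 k
... | j , eq = 4 ^ k + j , (begin
  4 * 4 ^ k + 2               ≡⟨ solve 1 (λ x → con 4 :* x :+ con 2 := con 3 :* x :+ (x :+ con 2)) refl (4 ^ k) ⟩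
  3 * 4 ^ k + (4 ^ k + 2)     ≡⟨ cong (3 * 4 ^ k +_) eq ⟩
  3 * 4 ^ k + 3 * j           ≡⟨ ℕ.*-distribˡ-+ 3 (4 ^ k) j ⟨
  3 * (4 ^ k + j)             ∎)
  where
  open ≡-Reasoning
  open ℕSolver.+-*-Solver

-- Finite fields: cancellation, powers, and `y ↑ q ≡ y`

module FiniteFieldProperties {q : ℕ} (F : FiniteField q) where

  open FiniteField F public
    using (inverse; 0≢1; enum; isCommutativeRing)
    renaming (Carrier to K; _+_ to _⊕_; _*_ to _⊗_; -_ to ⊖_; 0# to 𝟘; 1# to 𝟙; _^_ to infixr 9 _↑_)

  commutativeRing : CommutativeRing _ _
  commutativeRing = record { isCommutativeRing = isCommutativeRing }

  open CommutativeRing commutativeRing public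
    using (+-identityʳ; -‿inverseʳ; *-assoc; *-comm; *-identityˡ; *-identityʳ; zeroˡ; zeroʳ; distribʳ; *-commutativeMonoid; ring; *-commutativeSemigroup)
  open RingProperties ring using (-1*x≈-x; -‿involutive)
  open CommutativeSemigroupProperties *-commutativeSemigroup using (interchange; x∙yz≈y∙xz)
  open Sum *-commutativeMonoid
    renaming (sum to ∏) using (sum-remove; ∑-distrib-+; sum-permute; sum-cong-≗; sum-replicate-zero)
  open ≡-Reasoning

  element : Fin q → K
  element = Inverse.to enum

  index : K → Fin q
  index = Inverse.from enum

  element-index : ∀ x → element (index x) ≡ x
  element-index = Inverse.strictlyInverseˡ enum

  index-injective : Injective _≡_ _≡_ index
  index-injective {x} {y} eq = trans (sym (element-index x)) (trans (cong element eq) (element-index y))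

  infix 4 _≟_
  _≟_ : DecidableEquality K
  _≟_ = Fin.inj⇒≟ (↔⇒↣ (↔-sym enum))

  injective⇒bijective : (f : K → K) → Injective _≡_ _≡_ f → Bijective _≡_ _≡_ f
  injective⇒bijective f f-inj = f-inj , surjective
    where
    f̂ : Fin q → Fin q
    f̂ = index ∘ f ∘ element

    f̂-injective : Injective _≡_ _≡_ f̂
    f̂-injective eq = Injection.injective (↔⇒↣ enum) (f-inj (index-injective eq))

    surjective : Surjective _≡_ _≡_ f
    surjective y with Fin-injective⇒surjective f̂ f̂-injective (index y)
    ... | i , f̂i≡ = element i , λ { refl → index-injective f̂i≡ }

  *-cancelˡ : ∀ x {y z} → x ≢ 𝟘 → x ⊗ y ≡ x ⊗ z → y ≡ z
  *-cancelˡ x {y} {z} x≢0 xy≡xz with inverse x x≢0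
  ... | i , xi≡1 = trans (sym (undo y)) (trans (cong (i ⊗_) xy≡xz) (undo z))
    where
    undo : ∀ t → i ⊗ (x ⊗ t) ≡ t
    undo t = begin
      i ⊗ (x ⊗ t)  ≡⟨ *-assoc i x t ⟨
      i ⊗ x ⊗ t    ≡⟨ cong (_⊗ t) (trans (*-comm i x) xi≡1) ⟩
      𝟙 ⊗ t        ≡⟨ *-identityˡ t ⟩
      t            ∎

  *-cancelʳ : ∀ x {y z} → x ≢ 𝟘 → y ⊗ x ≡ z ⊗ x → y ≡ z
  *-cancelʳ x {y} {z} x≢0 yx≡zx = *-cancelˡ x x≢0 (trans (*-comm x y) (trans yx≡zx (*-comm z x)))

  x*y≡0⇒y≡0 : ∀ {x y} → x ≢ 𝟘 → x ⊗ y ≡ 𝟘 → y ≡ 𝟘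
  x*y≡0⇒y≡0 {x} x≢0 xy≡0 = *-cancelˡ x x≢0 (trans xy≡0 (sym (zeroʳ x)))

  *-≢0 : ∀ {x y} → x ≢ 𝟘 → y ≢ 𝟘 → x ⊗ y ≢ 𝟘
  *-≢0 x≢0 y≢0 = y≢0 ∘ x*y≡0⇒y≡0 x≢0

  1≢0 : 𝟙 ≢ 𝟘
  1≢0 = 0≢1 ∘ sym

  ↑-+ : ∀ x m n → x ↑ (m + n) ≡ x ↑ m ⊗ x ↑ n
  ↑-+ x zero    n = sym (*-identityˡ _)
  ↑-+ x (suc m) n = trans (cong (x ⊗_) (↑-+ x m n)) (sym (*-assoc x _ _))

  ↑-* : ∀ x m n → x ↑ (m * n) ≡ (x ↑ n) ↑ m
  ↑-* x zero    n = refl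
  ↑-* x (suc m) n = trans (↑-+ x n (m * n)) (cong (x ↑ n ⊗_) (↑-* x m n))

  ↑-distrib-* : ∀ x y n → (x ⊗ y) ↑ n ≡ x ↑ n ⊗ y ↑ n
  ↑-distrib-* x y zero    = sym (*-identityˡ 𝟙)
  ↑-distrib-* x y (suc n) = trans (cong (x ⊗ y ⊗_) (↑-distrib-* x y n)) (interchange x y _ _)

  1↑ : ∀ n → 𝟙 ↑ n ≡ 𝟙
  1↑ zero    = refl
  1↑ (suc n) = trans (*-identityˡ _) (1↑ n)

  ↑-≢0 : ∀ {x} n → x ≢ 𝟘 → x ↑ n ≢ 𝟘
  ↑-≢0 zero    x≢0 = 1≢0
  ↑-≢0 (suc n) x≢0 = *-≢0 x≢0 (↑-≢0 n x≢0)

  0↑ : ∀ n → .{{NonZero n}} → 𝟘 ↑ n ≡ 𝟘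
  0↑ (suc n) = zeroˡ _

  ∏-const : ∀ n x → ∏ {n} (λ _ → x) ≡ x ↑ n
  ∏-const zero    x = refl
  ∏-const (suc n) x = cong (x ⊗_) (∏-const n x)

  ∏-≢0 : ∀ {n} (f : Fin n → K) → (∀ i → f i ≢ 𝟘) → ∏ f ≢ 𝟘
  ∏-≢0 {zero}  f f≢0 = 1≢0
  ∏-≢0 {suc n} f f≢0 = *-≢0 (f≢0 Fin.zero) (∏-≢0 (f ∘ Fin.suc) (f≢0 ∘ Fin.suc))

  ∏-single : ∀ {n} (f : Fin n → K) i → (∀ j → j ≢ i → f j ≡ 𝟙) → ∏ f ≡ f i
  ∏-single {suc n} f i f≡1 = begin
    ∏ f                             ≡⟨ sum-remove {i = i} f ⟩
    f i ⊗ ∏ (λ j → f (punchIn i j)) ≡⟨ cong (f i ⊗_) (sum-cong-≗ λ j → f≡1 _ (Fin.punchInᵢ≢i i j)) ⟩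
    f i ⊗ ∏ {n} (λ _ → 𝟙)           ≡⟨ cong (f i ⊗_) (sum-replicate-zero n) ⟩
    f i ⊗ 𝟙                         ≡⟨ *-identityʳ (f i) ⟩
    f i                             ∎

  scaling : ∀ y → y ≢ 𝟘 → K ↔ K
  scaling y y≢0 = mk↔ₛ′ (y ⊗_) (i ⊗_) y∘i (λ x → trans (x∙yz≈y∙xz i y x) (y∘i x))
    where
    i : K
    i = proj₁ (inverse y y≢0)

    y∘i : ∀ x → y ⊗ (i ⊗ x) ≡ x
    y∘i x = trans (sym (*-assoc y i x)) (trans (cong (_⊗ x) (proj₂ (inverse y y≢0))) (*-identityˡ x))

  -- Multiplication by y permutes the field; compare the products of all
  -- elements with 0 replaced by 1.  The element 0 contributes the extra factor y.
  x^q≡x : .{{NonZero q}} → ∀ y → y ↑ q ≡ y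
  x^q≡x y with y ≟ 𝟘
  ... | yes refl = 0↑ q
  ... | no y≢0 = *-cancelʳ P P≢0 (begin
    y ↑ q ⊗ P                                            ≡⟨ cong (_⊗ P) (∏-const q y) ⟨
    ∏ (λ (i : Fin q) → y) ⊗ P                            ≡⟨ ∑-distrib-+ (λ _ → y) (unit ∘ element) ⟨
    ∏ (λ i → y ⊗ unit (element i))                       ≡⟨ sum-cong-≗ (λ i → scale (element i)) ⟩
    ∏ (λ i → correction (element i) ⊗ unit (y ⊗ element i)) ≡⟨ ∑-distrib-+ (correction ∘ element) (λ i → unit (y ⊗ element i)) ⟩
    ∏ (correction ∘ element) ⊗ ∏ (λ i → unit (y ⊗ element i)) ≡⟨ cong₂ _⊗_ ∏-correction (sym permuted) ⟩
    y ⊗ P                                                ∎)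
    where
    unit correction : K → K
    unit x with x ≟ 𝟘
    ... | yes _ = 𝟙
    ... | no  _ = x
    correction x with x ≟ 𝟘
    ... | yes _ = y
    ... | no  _ = 𝟙

    unit-≢0 : ∀ x → unit x ≢ 𝟘
    unit-≢0 x with x ≟ 𝟘
    ... | yes _   = 1≢0
    ... | no  x≢0 = x≢0

    P : K
    P = ∏ (unit ∘ element)

    P≢0 : P ≢ 𝟘
    P≢0 = ∏-≢0 (unit ∘ element) (unit-≢0 ∘ element)

    scale : ∀ x → y ⊗ unit x ≡ correction x ⊗ unit (y ⊗ x)
    scale x with x ≟ 𝟘 | y ⊗ x ≟ 𝟘
    ... | yes _    | yes _    = refl
    ... | yes refl | no yx≢0  = contradiction (zeroʳ y) yx≢0
    ... | no x≢0   | yes yx≡0 = contradiction yx≡0 (*-≢0 y≢0 x≢0)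
    ... | no _     | no _     = sym (*-identityˡ (y ⊗ x))

    correction-0 : ∀ {x} → x ≡ 𝟘 → correction x ≡ y
    correction-0 {x} x≡0 with x ≟ 𝟘
    ... | yes _  = refl
    ... | no x≢0 = contradiction x≡0 x≢0

    correction-≢0 : ∀ {x} → x ≢ 𝟘 → correction x ≡ 𝟙
    correction-≢0 {x} x≢0 with x ≟ 𝟘
    ... | yes x≡0 = contradiction x≡0 x≢0
    ... | no _    = refl

    ∏-correction : ∏ (correction ∘ element) ≡ y
    ∏-correction = trans
      (∏-single (correction ∘ element) (index 𝟘) λ j j≢ → correction-≢0 λ ej≡0 →
        j≢ (Injection.injective (↔⇒↣ enum) (trans ej≡0 (sym (element-index 𝟘)))))
      (correction-0 (element-index 𝟘))

    permuted : P ≡ ∏ (λ i → unit (y ⊗ element i))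
    permuted = trans
      -- Products are indexed by `Fin q`, so scaling by `y` is conjugated by `enum` to a permutation
      -- of indices.
      (sum-permute (unit ∘ element) (↔-trans enum (↔-trans (scaling y y≢0) (↔-sym enum))))
      (sum-cong-≗ {q} λ i → cong unit (element-index (y ⊗ element i)))

  -1↑4*n : ∀ n → (⊖ 𝟙) ↑ (4 * n) ≡ 𝟙
  -1↑4*n n = trans (cong ((⊖ 𝟙) ↑_) (ℕ.*-comm 4 n)) (trans (↑-* (⊖ 𝟙) n 4) (trans (cong (_↑ n) -1↑4) (1↑ n)))
    where
    -1*-1 : ⊖ 𝟙 ⊗ ⊖ 𝟙 ≡ 𝟙
    -1*-1 = trans (-1*x≈-x (⊖ 𝟙)) (-‿involutive 𝟙)

    -1↑4 : (⊖ 𝟙) ↑ 4 ≡ 𝟙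
    -1↑4 = begin
      ⊖ 𝟙 ⊗ (⊖ 𝟙 ⊗ (⊖ 𝟙 ⊗ (⊖ 𝟙 ⊗ 𝟙)))  ≡⟨ cong (λ t → ⊖ 𝟙 ⊗ (⊖ 𝟙 ⊗ (⊖ 𝟙 ⊗ t))) (*-identityʳ (⊖ 𝟙)) ⟩
      ⊖ 𝟙 ⊗ (⊖ 𝟙 ⊗ (⊖ 𝟙 ⊗ ⊖ 𝟙))        ≡⟨ cong (λ t → ⊖ 𝟙 ⊗ (⊖ 𝟙 ⊗ t)) -1*-1 ⟩
      ⊖ 𝟙 ⊗ (⊖ 𝟙 ⊗ 𝟙)                  ≡⟨ cong (⊖ 𝟙 ⊗_) (*-identityʳ (⊖ 𝟙)) ⟩
      ⊖ 𝟙 ⊗ ⊖ 𝟙                        ≡⟨ -1*-1 ⟩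
      𝟙                                ∎

-- Polynomial identities in characteristic 2

module Characteristic2 {q : ℕ} (F : FiniteField q)
  (1+1≡0 : FiniteField._+_ F (FiniteField.1# F) (FiniteField.1# F) ≡ FiniteField.0# F) where

  open FiniteFieldProperties F
  open ≡-Reasoning
  open CommutativeRing commutativeRing using (+-identityˡ)
  open RingProperties ring using (+-inverseʳ-unique; -0#≈0#)

  fromBool : Bool → K
  fromBool b = if b then 𝟙 else 𝟘

  -- Solver coefficients are taken in 𝔽₂, realised as `Bool` with xor and conjunction, so that
  -- normalisation itself cancels `x ⊕ x`.
  fromBool-morphism : CommutativeRing.rawRing Bool.xor-∧-commutativeRing -Raw-AlmostCommutative⟶ fromCommutativeRing commutativeRing
  fromBool-morphism = record
    { ⟦_⟧    = fromBool
    ; +-homo = λ { true true → sym 1+1≡0 ; true false → sym (+-identityʳ 𝟙) ; false b → sym (+-identityˡ (fromBool b)) }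
    ; *-homo = λ { true b → sym (*-identityˡ (fromBool b)) ; false b → sym (zeroˡ (fromBool b)) }
    ; -‿homo = λ { true → +-inverseʳ-unique 𝟙 𝟙 1+1≡0 ; false → sym -0#≈0# }
    ; 0-homo = refl
    ; 1-homo = refl
    }

  open Solver _ _ fromBool-morphism (λ a b → Maybe.map (cong fromBool) (dec⇒maybe (a Bool.≟ b))) public
    using (solve; con; _:=_; _:+_; _:*_)

  x+x≡0 : ∀ x → x ⊕ x ≡ 𝟘
  x+x≡0 = solve 1 (λ x → x :+ x := con false) refl

  x+y≡0⇒x≡y : ∀ {x y} → x ⊕ y ≡ 𝟘 → x ≡ y
  x+y≡0⇒x≡y {x} {y} x+y≡0 = begin
    x            ≡⟨ solve 2 (λ x y → x := x :+ y :+ y) refl x y ⟩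
    x ⊕ y ⊕ y    ≡⟨ cong (_⊕ y) x+y≡0 ⟩
    𝟘 ⊕ y        ≡⟨ +-identityˡ y ⟩
    y            ∎

  x≡y⇒x+y≡0 : ∀ {x y} → x ≡ y → x ⊕ y ≡ 𝟘
  x≡y⇒x+y≡0 refl = x+x≡0 _

  ↑4-additive : ∀ x y → (x ⊕ y) ↑ 4 ≡ x ↑ 4 ⊕ y ↑ 4
  ↑4-additive = solve 2 (λ x y → fourth (x :+ y) := fourth x :+ fourth y) refl
    where fourth = λ t → t :* (t :* (t :* (t :* con true)))

  ↑4^k-additive : ∀ k x y → (x ⊕ y) ↑ (4 ^ k) ≡ x ↑ (4 ^ k) ⊕ y ↑ (4 ^ k)
  ↑4^k-additive zero    x y = distribʳ 𝟙 x y
  ↑4^k-additive (suc k) x y = begin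
    (x ⊕ y) ↑ (4 * 4 ^ k)                     ≡⟨ ↑-* (x ⊕ y) 4 (4 ^ k) ⟩
    ((x ⊕ y) ↑ (4 ^ k)) ↑ 4                   ≡⟨ cong (_↑ 4) (↑4^k-additive k x y) ⟩
    (x ↑ (4 ^ k) ⊕ y ↑ (4 ^ k)) ↑ 4           ≡⟨ ↑4-additive _ _ ⟩
    (x ↑ (4 ^ k)) ↑ 4 ⊕ (y ↑ (4 ^ k)) ↑ 4     ≡⟨ cong₂ _⊕_ (↑-* x 4 (4 ^ k)) (↑-* y 4 (4 ^ k)) ⟨
    x ↑ (4 * 4 ^ k) ⊕ y ↑ (4 * 4 ^ k)         ∎

  -- In characteristic 2 this is `e₁² + e₂` in the elementary symmetric polynomials, so its value at
  -- three conjugates is fixed by Frobenius.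
  N : K → K → K → K
  N x y z = x ⊗ x ⊕ y ⊗ y ⊕ z ⊗ z ⊕ x ⊗ y ⊕ y ⊗ z ⊕ z ⊗ x

  N-cyclic : ∀ x y z → N y z x ≡ N x y z
  N-cyclic = solve 3 (λ x y z →
       y :* y :+ z :* z :+ x :* x :+ y :* z :+ z :* x :+ x :* y
    := x :* x :+ y :* y :+ z :* z :+ x :* y :+ y :* z :+ z :* x) refl

  -- The node is (1 : 1 : 1), with tangent cone `s² + s t + t²`; it is the only point of the curve
  -- with `x = z ≠ 0`.
  nodalCubic : K → K → K → K
  nodalCubic x y z = x ⊗ x ⊗ z ⊕ y ⊗ y ⊗ x ⊕ z ⊗ z ⊗ y ⊕ x ⊗ y ⊗ z

  -- With T = u + v + w the three relations are (x + y) u = y T, (y + z) v = z T,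
  -- (z + x) w = x T; multiply each by the coefficients of the other two and add.
  eliminate : ∀ x y z u v w →
    x ⊗ u ⊕ y ⊗ (v ⊕ w) ≡ 𝟘 → y ⊗ v ⊕ z ⊗ (w ⊕ u) ≡ 𝟘 → z ⊗ w ⊕ x ⊗ (u ⊕ v) ≡ 𝟘 →
    (u ⊕ v ⊕ w) ⊗ nodalCubic x y z ≡ 𝟘
  eliminate x y z u v w e₁ e₂ e₃ = begin
    (u ⊕ v ⊕ w) ⊗ nodalCubic x y z
      ≡⟨ solve 6 (λ x y z u v w →
             (u :+ v :+ w) :* (x :* x :* z :+ y :* y :* x :+ z :* z :* y :+ x :* y :* z)
          := (y :+ z) :* (z :+ x) :* (x :* u :+ y :* (v :+ w))
          :+ (z :+ x) :* (x :+ y) :* (y :* v :+ z :* (w :+ u))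
          :+ (x :+ y) :* (y :+ z) :* (z :* w :+ x :* (u :+ v))) refl x y z u v w ⟩
    (y ⊕ z) ⊗ (z ⊕ x) ⊗ (x ⊗ u ⊕ y ⊗ (v ⊕ w))
      ⊕ (z ⊕ x) ⊗ (x ⊕ y) ⊗ (y ⊗ v ⊕ z ⊗ (w ⊕ u))
      ⊕ (x ⊕ y) ⊗ (y ⊕ z) ⊗ (z ⊗ w ⊕ x ⊗ (u ⊕ v))
      ≡⟨ cong₂ _⊕_ (cong₂ _⊕_ (cong (_ ⊗_) e₁) (cong (_ ⊗_) e₂)) (cong (_ ⊗_) e₃) ⟩
    (y ⊕ z) ⊗ (z ⊕ x) ⊗ 𝟘 ⊕ (z ⊕ x) ⊗ (x ⊕ y) ⊗ 𝟘 ⊕ (x ⊕ y) ⊗ (y ⊕ z) ⊗ 𝟘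
      ≡⟨ solve 3 (λ a b c → a :* con false :+ b :* con false :+ c :* con false := con false) refl _ _ _ ⟩
    𝟘 ∎

  -- The two sides differ by exactly the cubic. When `y` and `z` are the successive conjugates of
  -- `x`, the factor `y ⊕ x` is the conjugate of `x ⊕ z`, so the right side becomes a `(Q + 2)`-th
  -- power.
  nodalCubic⇒factorisation : ∀ x y z → nodalCubic x y z ≡ 𝟘 →
    x ⊗ N x y z ≡ (y ⊕ x) ⊗ ((x ⊕ z) ⊗ (x ⊕ z))
  nodalCubic⇒factorisation x y z on-curve = begin
    x ⊗ N x y z
      ≡⟨ solve 3 (λ x y z →
             x :* (x :* x :+ y :* y :+ z :* z :+ x :* y :+ y :* z :+ z :* x)
          := (y :+ x) :* ((x :+ z) :* (x :+ z))
          :+ (x :* x :* z :+ y :* y :* x :+ z :* z :* y :+ x :* y :* z)) refl x y z ⟩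
    (y ⊕ x) ⊗ ((x ⊕ z) ⊗ (x ⊕ z)) ⊕ nodalCubic x y z
      ≡⟨ cong (_ ⊕_) on-curve ⟩
    (y ⊕ x) ⊗ ((x ⊕ z) ⊗ (x ⊕ z)) ⊕ 𝟘
      ≡⟨ +-identityʳ _ ⟩
    (y ⊕ x) ⊗ ((x ⊕ z) ⊗ (x ⊕ z)) ∎

-- The field of order `Q ^ 3` and its Frobenius map `σ`

module CubicExtension (k : ℕ) .{{_ : NonZero k}} (F : FiniteField ((4 ^ k) ^ 3)) where

  open FiniteFieldProperties F
  open ≡-Reasoning

  Q : ℕ
  Q = 4 ^ k

  σ : K → K
  σ x = x ↑ Q

  Q≢0 : NonZero Q
  Q≢0 = ℕ.m^n≢0 4 k

  σσσ≡id : ∀ x → σ (σ (σ x)) ≡ x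
  σσσ≡id x = begin
    ((x ↑ Q) ↑ Q) ↑ Q      ≡⟨ cong (_↑ Q) (↑-* x Q Q) ⟨
    (x ↑ (Q * Q)) ↑ Q      ≡⟨ ↑-* x Q (Q * Q) ⟨
    x ↑ (Q * (Q * Q))      ≡⟨ cong (λ n → x ↑ (Q * (Q * n))) (ℕ.*-identityʳ Q) ⟨
    x ↑ (Q ^ 3)            ≡⟨ x^q≡x {{ℕ.m^n≢0 Q 3 {{Q≢0}}}} x ⟩
    x                      ∎

  σ-1≡1 : σ (⊖ 𝟙) ≡ 𝟙
  σ-1≡1 = go k
    where
    go : ∀ k → .{{NonZero k}} → (⊖ 𝟙) ↑ (4 ^ k) ≡ 𝟙
    go (suc k) = -1↑4*n (4 ^ k)

  -- As 4 divides `Q`, `σ` sends `⊖ 𝟙` to `𝟙`; but `σ` applied three times is the identity, which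
  -- forces `⊖ 𝟙 ≡ 𝟙`.
  1+1≡0 : 𝟙 ⊕ 𝟙 ≡ 𝟘
  1+1≡0 = trans (cong (𝟙 ⊕_) (sym -1≡1)) (-‿inverseʳ 𝟙)
    where
    -1≡1 : ⊖ 𝟙 ≡ 𝟙
    -1≡1 = begin
      ⊖ 𝟙              ≡⟨ σσσ≡id (⊖ 𝟙) ⟨
      σ (σ (σ (⊖ 𝟙)))  ≡⟨ cong (σ ∘ σ) σ-1≡1 ⟩
      σ (σ 𝟙)          ≡⟨ cong σ (1↑ Q) ⟩
      σ 𝟙              ≡⟨ 1↑ Q ⟩
      𝟙                ∎

  open Characteristic2 F 1+1≡0

  σ-+ : ∀ x y → σ (x ⊕ y) ≡ σ x ⊕ σ y
  σ-+ = ↑4^k-additive k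

  σ-* : ∀ x y → σ (x ⊗ y) ≡ σ x ⊗ σ y
  σ-* x y = ↑-distrib-* x y Q

  σ-0 : σ 𝟘 ≡ 𝟘
  σ-0 = 0↑ Q {{Q≢0}}

  x*x^[Q-1]≡σx : ∀ x → x ⊗ x ↑ (Q ∸ 1) ≡ σ x
  x*x^[Q-1]≡σx x = cong (x ↑_) (ℕ.suc-pred Q {{Q≢0}})

  x^[Q+2] : ∀ x → x ↑ (Q + 2) ≡ σ x ⊗ (x ⊗ x)
  x^[Q+2] x = trans (↑-+ x Q 2) (cong (λ t → σ x ⊗ (x ⊗ t)) (*-identityʳ x))

  x^[Q²+Q] : ∀ x → x ↑ (Q * Q + Q) ≡ σ (σ x) ⊗ σ x
  x^[Q²+Q] x = trans (↑-+ x (Q * Q) Q) (cong (_⊗ σ x) (↑-* x Q Q))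

  fixed⇒^[Q-1]≡1 : ∀ {f} → f ≢ 𝟘 → σ f ≡ f → f ↑ (Q ∸ 1) ≡ 𝟙
  fixed⇒^[Q-1]≡1 {f} f≢0 σf≡f = *-cancelˡ f f≢0 (trans (x*x^[Q-1]≡σx f) (trans σf≡f (sym (*-identityʳ f))))

  -- From the conjugated relations to `(Q + 2)`-th powers modulo the fixed field

  σ-relation : ∀ x u v w → x ⊗ u ⊕ σ x ⊗ (v ⊕ w) ≡ 𝟘 → σ x ⊗ σ u ⊕ σ (σ x) ⊗ (σ v ⊕ σ w) ≡ 𝟘
  σ-relation x u v w eq = begin
    σ x ⊗ σ u ⊕ σ (σ x) ⊗ (σ v ⊕ σ w)   ≡⟨ cong (λ t → σ x ⊗ σ u ⊕ σ (σ x) ⊗ t) (σ-+ v w) ⟨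
    σ x ⊗ σ u ⊕ σ (σ x) ⊗ σ (v ⊕ w)     ≡⟨ cong₂ _⊕_ (σ-* x u) (σ-* (σ x) (v ⊕ w)) ⟨
    σ (x ⊗ u) ⊕ σ (σ x ⊗ (v ⊕ w))       ≡⟨ σ-+ _ _ ⟨
    σ (x ⊗ u ⊕ σ x ⊗ (v ⊕ w))           ≡⟨ cong σ eq ⟩
    σ 𝟘                                 ≡⟨ σ-0 ⟩
    𝟘                                   ∎

  -- The condition `σ f ≡ f` places `f` in 𝔽_Q*, so raising to the power `Q ∸ 1` removes it.
  IsPowerModFixed : K → Set
  IsPowerModFixed h = Σ K λ f → Σ K λ n → (f ≢ 𝟘) × (n ≢ 𝟘) × (σ f ≡ f) × (h ⊗ f ≡ n ↑ (Q + 2))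

  -- When `σ h ≡ h`, the power `h ↑ (Q + 2)` is the cube of `h`, which suggests the witnesses
  -- `h ⊗ h` and `h`.
  fixed⇒powerModFixed : ∀ {h} → h ≢ 𝟘 → σ h ≡ h → IsPowerModFixed h
  fixed⇒powerModFixed {h} h≢0 σh≡h =
    h ⊗ h , h , *-≢0 h≢0 h≢0 , h≢0 , trans (σ-* h h) (cong₂ _⊗_ σh≡h σh≡h) ,
    sym (trans (x^[Q+2] h) (cong (_⊗ (h ⊗ h)) σh≡h))

  nodalCubic⇒powerModFixed : ∀ {h} → h ≢ 𝟘 → nodalCubic h (σ h) (σ (σ h)) ≡ 𝟘 → IsPowerModFixed h
  nodalCubic⇒powerModFixed {h} h≢0 on-curve with h ⊕ σ (σ h) ≟ 𝟘
  -- The factorisation is useless for `n = 0`, but then `h` equals `σ (σ h)`, and one more `σ` shows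
  -- that `h` is fixed.
  ... | yes n≡0 = fixed⇒powerModFixed h≢0 (trans (cong σ (x+y≡0⇒x≡y n≡0)) (σσσ≡id h))
  ... | no n≢0 = f , n , f≢0 , n≢0 , σf≡f , hf≡
    where
    n f : K
    n = h ⊕ σ (σ h)
    f = N h (σ h) (σ (σ h))

    hf≡ : h ⊗ f ≡ n ↑ (Q + 2)
    hf≡ = begin
      h ⊗ f                        ≡⟨ nodalCubic⇒factorisation h (σ h) (σ (σ h)) on-curve ⟩
      -- Rewriting `h` as its third conjugate exhibits `σ h ⊕ h` as `σ n`.
      (σ h ⊕ h) ⊗ (n ⊗ n)          ≡⟨ cong (λ t → (σ h ⊕ t) ⊗ (n ⊗ n)) (σσσ≡id h) ⟨
      (σ h ⊕ σ (σ (σ h))) ⊗ (n ⊗ n) ≡⟨ cong (_⊗ (n ⊗ n)) (σ-+ h (σ (σ h))) ⟨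
      σ n ⊗ (n ⊗ n)                ≡⟨ x^[Q+2] n ⟨
      n ↑ (Q + 2)                  ∎

    f≢0 : f ≢ 𝟘
    f≢0 f≡0 = ↑-≢0 (Q + 2) n≢0 (trans (sym hf≡) (trans (cong (h ⊗_) f≡0) (zeroʳ h)))

    σ-N : ∀ x y z → σ (N x y z) ≡ N (σ x) (σ y) (σ z)
    σ-N x y z =
      trans (σ-+ _ _) (cong₂ _⊕_
        (trans (σ-+ _ _) (cong₂ _⊕_
          (trans (σ-+ _ _) (cong₂ _⊕_
            (trans (σ-+ _ _) (cong₂ _⊕_
              (trans (σ-+ _ _) (cong₂ _⊕_ (σ-* x x) (σ-* y y)))
              (σ-* z z)))
            (σ-* x y)))
          (σ-* y z)))
        (σ-* z x))

    σf≡f : σ f ≡ f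
    σf≡f = begin
      σ f                                   ≡⟨ σ-N h (σ h) (σ (σ h)) ⟩
      N (σ h) (σ (σ h)) (σ (σ (σ h)))       ≡⟨ cong (N (σ h) (σ (σ h))) (σσσ≡id h) ⟩
      N (σ h) (σ (σ h)) h                   ≡⟨ N-cyclic h (σ h) (σ (σ h)) ⟩
      f                                     ∎

  relation⇒powerModFixed : ∀ {h u} → h ≢ 𝟘 → u ≢ 𝟘 →
    h ⊗ u ⊕ σ h ⊗ (σ u ⊕ σ (σ u)) ≡ 𝟘 → IsPowerModFixed h
  relation⇒powerModFixed {h} {u} h≢0 u≢0 e₁ with u ⊕ σ u ⊕ σ (σ u) ≟ 𝟘
  -- With trace zero, `σ u ⊕ σ (σ u)` equals `u`, so the relation collapses to `u ⊗ (h ⊕ σ h) ≡ 𝟘`.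
  ... | yes T≡0 = fixed⇒powerModFixed h≢0 (sym (x+y≡0⇒x≡y (x*y≡0⇒y≡0 u≢0 (begin
    u ⊗ (h ⊕ σ h)
      ≡⟨ solve 5 (λ x y u v w → u :* (x :+ y) := x :* u :+ y :* (v :+ w) :+ y :* (u :+ v :+ w)) refl h (σ h) u (σ u) (σ (σ u)) ⟩
    h ⊗ u ⊕ σ h ⊗ (σ u ⊕ σ (σ u)) ⊕ σ h ⊗ (u ⊕ σ u ⊕ σ (σ u))
      ≡⟨ cong₂ _⊕_ e₁ (trans (cong (σ h ⊗_) T≡0) (zeroʳ (σ h))) ⟩
    𝟘 ⊕ 𝟘
      ≡⟨ +-identityʳ 𝟘 ⟩
    𝟘 ∎))))
  ... | no T≢0 = nodalCubic⇒powerModFixed h≢0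
    (x*y≡0⇒y≡0 T≢0 (eliminate h (σ h) (σ (σ h)) u (σ u) (σ (σ u)) e₁ e₂ e₃))
    where
    -- The two conjugates of `e₁`, with third conjugates reduced to `h` and `u`, complete the cyclic
    -- system that `eliminate` expects.
    e₂ : σ h ⊗ σ u ⊕ σ (σ h) ⊗ (σ (σ u) ⊕ u) ≡ 𝟘
    e₂ = subst (λ t → σ h ⊗ σ u ⊕ σ (σ h) ⊗ (σ (σ u) ⊕ t) ≡ 𝟘) (σσσ≡id u) (σ-relation h u (σ u) (σ (σ u)) e₁)

    e₃ : σ (σ h) ⊗ σ (σ u) ⊕ h ⊗ (u ⊕ σ u) ≡ 𝟘
    e₃ = subst (λ t → σ (σ h) ⊗ σ (σ u) ⊕ h ⊗ (t ⊕ σ u) ≡ 𝟘) (σσσ≡id u)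
      (subst (λ t → σ (σ h) ⊗ σ (σ u) ⊕ t ⊗ (σ (σ (σ u)) ⊕ σ u) ≡ 𝟘) (σσσ≡id h)
        (σ-relation (σ h) (σ u) (σ (σ u)) u e₂))

  -- Dividing by `d ↑ (Q + 2)` gives `b ⊗ f ≡ g ↑ (Q + 2)` with `g = n / d`. The power `Q ∸ 1` kills
  -- `f`, and writing `Q + 2` as `3 * j` makes `g ↑ j` the required root.
  powerModFixed⇒power : ∀ {b d} → d ≢ 𝟘 → IsPowerModFixed (b ⊗ d ↑ (Q + 2)) →
    IsPowerIn* F (3 * (Q ∸ 1)) (b ↑ (Q ∸ 1))
  powerModFixed⇒power {b} {d} d≢0 (f , n , f≢0 , n≢0 , σf≡f , hf≡)
    with inverse d d≢0 | 3∣4^k+2 k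
  ... | i , di≡1 | j , Q+2≡3j = g ↑ j , ↑-≢0 j g≢0 , (begin
    (g ↑ j) ↑ (3 * (Q ∸ 1))       ≡⟨ cong ((g ↑ j) ↑_) (ℕ.*-comm 3 (Q ∸ 1)) ⟩
    (g ↑ j) ↑ ((Q ∸ 1) * 3)       ≡⟨ ↑-* (g ↑ j) (Q ∸ 1) 3 ⟩
    ((g ↑ j) ↑ 3) ↑ (Q ∸ 1)       ≡⟨ cong (_↑ (Q ∸ 1)) (↑-* g 3 j) ⟨
    (g ↑ (3 * j)) ↑ (Q ∸ 1)       ≡⟨ cong (λ m → (g ↑ m) ↑ (Q ∸ 1)) Q+2≡3j ⟨
    (g ↑ (Q + 2)) ↑ (Q ∸ 1)       ≡⟨ cong (_↑ (Q ∸ 1)) bf≡ ⟨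
    (b ⊗ f) ↑ (Q ∸ 1)             ≡⟨ ↑-distrib-* b f (Q ∸ 1) ⟩
    b ↑ (Q ∸ 1) ⊗ f ↑ (Q ∸ 1)     ≡⟨ cong (b ↑ (Q ∸ 1) ⊗_) (fixed⇒^[Q-1]≡1 f≢0 σf≡f) ⟩
    b ↑ (Q ∸ 1) ⊗ 𝟙               ≡⟨ *-identityʳ _ ⟩
    b ↑ (Q ∸ 1)                   ∎)
    where
    g : K
    g = n ⊗ i

    gd≡n : g ⊗ d ≡ n
    gd≡n = trans (*-assoc n i d) (trans (cong (n ⊗_) (trans (*-comm i d) di≡1)) (*-identityʳ n))

    g≢0 : g ≢ 𝟘
    g≢0 g≡0 = n≢0 (trans (sym gd≡n) (trans (cong (_⊗ d) g≡0) (zeroˡ d)))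

    D : K
    D = d ↑ (Q + 2)

    bf≡ : b ⊗ f ≡ g ↑ (Q + 2)
    bf≡ = *-cancelʳ D (↑-≢0 (Q + 2) d≢0) (begin
      b ⊗ f ⊗ D              ≡⟨ solve 3 (λ b f D → b :* f :* D := b :* D :* f) refl b f D ⟩
      b ⊗ D ⊗ f              ≡⟨ hf≡ ⟩
      n ↑ (Q + 2)            ≡⟨ cong (_↑ (Q + 2)) gd≡n ⟨
      (g ⊗ d) ↑ (Q + 2)      ≡⟨ ↑-distrib-* g d (Q + 2) ⟩
      g ↑ (Q + 2) ⊗ D        ∎)

  -- Planarity as triviality of a kernel

  module _ (a d : K) where

    difference : K → K
    difference c = a ⊗ (c ⊕ d) ↑ (Q * Q + Q) ⊕ a ⊗ c ↑ (Q * Q + Q) ⊕ d ⊗ c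

    linearPart : K → K
    linearPart e = a ⊗ (σ e ⊗ σ (σ d) ⊕ σ (σ e) ⊗ σ d) ⊕ d ⊗ e

    -- Since `c ↑ (Q * Q + Q)` is a product of two additive maps, the terms quadratic in `c` cancel
    -- in characteristic 2.
    difference-affine : ∀ c → difference c ≡ linearPart c ⊕ a ⊗ (σ (σ d) ⊗ σ d)
    difference-affine c = begin
      difference c
        ≡⟨ cong₂ (λ s t → a ⊗ s ⊕ a ⊗ t ⊕ d ⊗ c) (x^[Q²+Q] (c ⊕ d)) (x^[Q²+Q] c) ⟩
      a ⊗ (σ (σ (c ⊕ d)) ⊗ σ (c ⊕ d)) ⊕ a ⊗ (σ (σ c) ⊗ σ c) ⊕ d ⊗ c
        ≡⟨ cong₂ (λ s t → a ⊗ (s ⊗ t) ⊕ a ⊗ (σ (σ c) ⊗ σ c) ⊕ d ⊗ c)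
             (trans (cong σ (σ-+ c d)) (σ-+ (σ c) (σ d))) (σ-+ c d) ⟩
      a ⊗ ((σ (σ c) ⊕ σ (σ d)) ⊗ (σ c ⊕ σ d)) ⊕ a ⊗ (σ (σ c) ⊗ σ c) ⊕ d ⊗ c
        ≡⟨ solve 7 (λ a c c′ c″ d d′ d″ →
               a :* ((c″ :+ d″) :* (c′ :+ d′)) :+ a :* (c″ :* c′) :+ d :* c
            := a :* (c′ :* d″ :+ c″ :* d′) :+ d :* c :+ a :* (d″ :* d′))
             refl a c (σ c) (σ (σ c)) d (σ d) (σ (σ d)) ⟩
      linearPart c ⊕ a ⊗ (σ (σ d) ⊗ σ d) ∎

    linearPart-+ : ∀ x y → linearPart (x ⊕ y) ≡ linearPart x ⊕ linearPart y
    linearPart-+ x y = begin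
      linearPart (x ⊕ y)
        ≡⟨ cong₂ (λ s t → a ⊗ (s ⊗ σ (σ d) ⊕ t ⊗ σ d) ⊕ d ⊗ (x ⊕ y))
             (σ-+ x y) (trans (cong σ (σ-+ x y)) (σ-+ (σ x) (σ y))) ⟩
      a ⊗ ((σ x ⊕ σ y) ⊗ σ (σ d) ⊕ (σ (σ x) ⊕ σ (σ y)) ⊗ σ d) ⊕ d ⊗ (x ⊕ y)
        ≡⟨ solve 10 (λ a d d′ d″ x x′ x″ y y′ y″ →
               a :* ((x′ :+ y′) :* d″ :+ (x″ :+ y″) :* d′) :+ d :* (x :+ y)
            := a :* (x′ :* d″ :+ x″ :* d′) :+ d :* x :+ (a :* (y′ :* d″ :+ y″ :* d′) :+ d :* y))
             refl a d (σ d) (σ (σ d)) x (σ x) (σ (σ x)) y (σ y) (σ (σ y)) ⟩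
      linearPart x ⊕ linearPart y ∎

    -- The constant term cancels between two values of `difference`, so a trivial kernel gives
    -- injectivity, which suffices on a finite set.
    trivialKernel⇒bijective : (∀ e → linearPart e ≡ 𝟘 → e ≡ 𝟘) → Bijective _≡_ _≡_ difference
    trivialKernel⇒bijective trivial = injective⇒bijective difference λ {x} {y} eq →
      x+y≡0⇒x≡y (trivial (x ⊕ y) (begin
        linearPart (x ⊕ y)
          ≡⟨ linearPart-+ x y ⟩
        linearPart x ⊕ linearPart y
          ≡⟨ solve 3 (λ s t c → s :+ t := s :+ c :+ (t :+ c)) refl _ _ (a ⊗ (σ (σ d) ⊗ σ d)) ⟩
        linearPart x ⊕ a ⊗ (σ (σ d) ⊗ σ d) ⊕ (linearPart y ⊕ a ⊗ (σ (σ d) ⊗ σ d))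
          ≡⟨ cong₂ _⊕_ (difference-affine x) (difference-affine y) ⟨
        difference x ⊕ difference y
          ≡⟨ x≡y⇒x+y≡0 eq ⟩
        𝟘 ∎))

  -- Multiply the kernel equation at `d ⊗ u` by `b ⊗ σ d`. The coefficient of `u` becomes `h`; that
  -- of `σ u ⊕ σ (σ u)` becomes `σ h`, because `b ⊗ b ↑ (Q ∸ 1)` is `σ b`.
  kernel⇒relation : ∀ b d u → linearPart (b ↑ (Q ∸ 1)) d (d ⊗ u) ≡ 𝟘 →
    let h = b ⊗ d ↑ (Q + 2) in h ⊗ u ⊕ σ h ⊗ (σ u ⊕ σ (σ u)) ≡ 𝟘
  kernel⇒relation b d u ker = begin
    h ⊗ u ⊕ σ h ⊗ (σ u ⊕ σ (σ u))
      ≡⟨ cong₂ (λ s t → s ⊗ u ⊕ t ⊗ (σ u ⊕ σ (σ u))) h≡ σh≡ ⟩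
    b ⊗ (d′ ⊗ (d ⊗ d)) ⊗ u ⊕ b ⊗ a ⊗ (d″ ⊗ (d′ ⊗ d′)) ⊗ (σ u ⊕ σ (σ u))
      ≡⟨ solve 8 (λ a b d d′ d″ u u′ u″ →
             b :* (d′ :* (d :* d)) :* u :+ b :* a :* (d″ :* (d′ :* d′)) :* (u′ :+ u″)
          := b :* d′ :* (a :* (d′ :* u′ :* d″ :+ d″ :* u″ :* d′) :+ d :* (d :* u)))
           refl a b d d′ d″ u (σ u) (σ (σ u)) ⟩
    b ⊗ d′ ⊗ (a ⊗ (d′ ⊗ σ u ⊗ d″ ⊕ d″ ⊗ σ (σ u) ⊗ d′) ⊕ d ⊗ (d ⊗ u))
      ≡⟨ cong₂ (λ s t → b ⊗ d′ ⊗ (a ⊗ (s ⊗ d″ ⊕ t ⊗ d′) ⊕ d ⊗ (d ⊗ u)))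
           (σ-* d u) (trans (cong σ (σ-* d u)) (σ-* d′ (σ u))) ⟨
    b ⊗ d′ ⊗ linearPart a d (d ⊗ u)
      ≡⟨ cong (b ⊗ d′ ⊗_) ker ⟩
    b ⊗ d′ ⊗ 𝟘
      ≡⟨ zeroʳ _ ⟩
    𝟘 ∎
    where
    a d′ d″ h : K
    a  = b ↑ (Q ∸ 1)
    d′ = σ d
    d″ = σ d′
    h  = b ⊗ d ↑ (Q + 2)

    h≡ : h ≡ b ⊗ (d′ ⊗ (d ⊗ d))
    h≡ = cong (b ⊗_) (x^[Q+2] d)

    σh≡ : σ h ≡ b ⊗ a ⊗ (d″ ⊗ (d′ ⊗ d′))
    σh≡ = begin
      σ h                                ≡⟨ cong σ h≡ ⟩
      σ (b ⊗ (d′ ⊗ (d ⊗ d)))             ≡⟨ σ-* b _ ⟩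
      σ b ⊗ σ (d′ ⊗ (d ⊗ d))             ≡⟨ cong₂ _⊗_ (sym (x*x^[Q-1]≡σx b)) (trans (σ-* d′ _) (cong (d″ ⊗_) (σ-* d d))) ⟩
      b ⊗ a ⊗ (d″ ⊗ (d′ ⊗ d′))           ∎

  kernel-trivial : ∀ {b} → b ≢ 𝟘 → ¬ IsPowerIn* F (3 * (Q ∸ 1)) (b ↑ (Q ∸ 1)) →
    ∀ d → d ≢ 𝟘 → ∀ e → linearPart (b ↑ (Q ∸ 1)) d e ≡ 𝟘 → e ≡ 𝟘
  kernel-trivial {b} b≢0 not-power d d≢0 e ker with e ≟ 𝟘 | inverse d d≢0
  ... | yes e≡0 | _ = e≡0
  ... | no e≢0 | i , di≡1 = contradiction
    (powerModFixed⇒power {b} d≢0 (relation⇒powerModFixed (*-≢0 b≢0 (↑-≢0 (Q + 2) d≢0)) u≢0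
      (kernel⇒relation b d u (trans (cong (linearPart (b ↑ (Q ∸ 1)) d) du≡e) ker))))
    not-power
    where
    u : K
    u = i ⊗ e

    du≡e : d ⊗ u ≡ e
    du≡e = trans (sym (*-assoc d i e)) (trans (cong (_⊗ e) di≡1) (*-identityˡ e))

    u≢0 : u ≢ 𝟘
    u≢0 u≡0 = e≢0 (trans (sym du≡e) (trans (cong (d ⊗_) u≡0) (zeroʳ d)))

theorem1 : (k : ℕ) → .{{_ : NonZero k}} →
    (F : FiniteField ((4 ^ k) ^ 3)) →
    (a : Carrier F) → a ≢ 0# F →
    IsPowerIn* F (4 ^ k ∸ 1) a →
    ¬ IsPowerIn* F (3 * (4 ^ k ∸ 1)) a →
    Planar F (λ c → FiniteField._*_ F a (FiniteField._^_ F c (4 ^ k * 4 ^ k + 4 ^ k)))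
-- Matching on `refl` replaces `a` by `b ↑ (Q ∸ 1)`; the map in `Planar` is then definitionally
-- `difference a d`.
theorem1 k F a _ (b , b≢0 , refl) not-power d d≢0 =
  trivialKernel⇒bijective a d (kernel-trivial b≢0 not-power d d≢0)
  where open CubicExtension k F
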